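{- For all positive integers $n\geq 2$ and $t$, the domination number of the Sierpiński graph $S(K_n,t)$ is $$\gamma(S(K_n,t))=\left\lceil\frac{n^t}{n+1}\right\rceil.$$
   Context: For a positive integer $n$ let $[n]=\{1,\dots,n\}$. For positive integers $n,t$, the Sierpiński graph $S(K_n,t)$ is the simple graph with vertex set $[n]^t$ (words $v_1v_2\cdots v_t$ with $v_i\in[n]$), in which $u_1\cdots u_t$ and $v_1\cdots v_t$ are adjacent if and only if there is $s\in[t]$ with $u_j=v_j$ for all $j<s$, $u_s\neq v_s$, and $u_j=v_s$ and $v_j=u_s$ for all $j>s$. A set $D$ of vertices of a graph $G$ is dominating if every vertex of $G$ lies in $D$ or is adjacent to a vertex of $D$; the domination number $\gamma(G)$ is the minimum size of a dominating set. -}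

module Defs where

open import Data.Fin.Base using (Fin; _<_)
open import Data.List.Base using (List; length)
open import Data.List.Membership.Propositional using (_∈_)
open import Data.List.Relation.Unary.Unique.Propositional using (Unique)
open import Data.Nat.Base using (ℕ; _≤_)
open import Data.Product.Base using (_×_; _,_; proj₁; proj₂; ∃-syntax)
open import Data.Sum.Base using (_⊎_)
open import Data.Vec.Base using (Vec; lookup)
open import Relation.Binary.Core using (Rel)
open import Relation.Binary.Definitions using (Symmetric; Irreflexive)
open import Relation.Binary.PropositionalEquality.Core
  using (_≡_; _≢_; refl; sym; ≢-sym)
open import Level using (0ℓ)

record SimpleGraph : Set₁ where
  field
    Vertex   : Set
    _~_      : Rel Vertex 0ℓ
    ~-sym    : Symmetric _~_
    ~-irrefl : Irreflexive _≡_ _~_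

module _ (G : SimpleGraph) where
  open SimpleGraph G

  IsDominating : List Vertex → Set
  IsDominating D = ∀ v → v ∈ D ⊎ (∃[ u ] u ∈ D × v ~ u)

  -- Finite vertex sets are duplicate-free lists, so that `length` is
  -- cardinality.
  IsDominatingSet : List Vertex → Set
  IsDominatingSet D = Unique D × IsDominating D

  -- The relation γ(G) = k; such a k is unique, being a minimum.
  IsDominationNumber : ℕ → Set
  IsDominationNumber k =
    (∃[ D ] IsDominatingSet D × length D ≡ k) ×
    (∀ D → IsDominatingSet D → k ≤ length D)

-- Letters and positions are indexed from 0 rather than from 1.
module _ {n t : ℕ} where

  SierpińskiAdj : Rel (Vec (Fin n) t) 0ℓ
  SierpińskiAdj u v = ∃[ s ]
    (∀ j → j < s → lookup u j ≡ lookup v j) ×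
    lookup u s ≢ lookup v s ×
    (∀ j → s < j → lookup u j ≡ lookup v s × lookup v j ≡ lookup u s)

  SierpińskiAdj-sym : Symmetric SierpińskiAdj
  SierpińskiAdj-sym (s , before , differ , after) =
    s , (λ j j<s → sym (before j j<s)) , ≢-sym differ ,
    (λ j s<j → proj₂ (after j s<j) , proj₁ (after j s<j))

  SierpińskiAdj-irrefl : Irreflexive _≡_ SierpińskiAdj
  SierpińskiAdj-irrefl refl (_ , _ , differ , _) = differ refl

Sierpiński : ℕ → ℕ → SimpleGraph
Sierpiński n t = record
  { Vertex   = Vec (Fin n) t
  ; _~_      = SierpińskiAdj
  ; ~-sym    = λ {u} {v} → SierpińskiAdj-sym {x = u} {v}
  ; ~-irrefl = λ {u} {v} → SierpińskiAdj-irrefl {x = u} {v}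
  }

{-# OPTIONS --safe #-}
-- The neighbours of u are words obtained by replacing its last letter, and at
-- most one further word, so a closed neighbourhood has at most n + 1 elements
-- and n^t ≤ (n + 1)|D| for every dominating set D.
--
-- Dominating sets attaining the bound are glued from sets in the n copies
-- j·S(K_n,t-1).  Copies i ≠ j are joined by the edge between i·j^{t-1} and
-- j·i^{t-1}, so an extreme vertex may be left undominated inside a copy when
-- its neighbour in another copy is chosen.  The induction therefore carries,
-- for even t, a dominating set containing every extreme vertex, of size
-- (n^t+n)/(n+1), and sets dominating everything but i^t, of size
-- (n^t-1)/(n+1); for odd t, dominating sets containing i^t, of size
-- (n^t+1)/(n+1), and a set dominating every non-extreme vertex, of size
-- (n^t-n)/(n+1).
module Submission where

open import Defs
open import Data.Nat.Base using (ℕ; suc; _≤_; _^_)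
open import Data.Integer.Base using (+_)
open import Data.Rational.Unnormalised.Base using (_/_; ceiling)
open import Data.Product.Base using (_×_; ∃-syntax)
open import Relation.Binary.PropositionalEquality.Core using (_≡_)

open import Data.Fin.Base using (Fin; zero; suc; combine; finToFun; funToFin)
open import Data.Fin.Properties
  using (_≟_; any?; combine-injective; funToFin-finToFin; injective⇒≤)
import Data.Integer.Base as ℤ
import Data.Integer.DivMod as ℤ
import Data.Integer.Properties as ℤ
import Data.Integer.Tactic.RingSolver as ℤ
open import Data.List.Base as List
  using (List; []; _∷_; length; map; concat; tabulate; deduplicate)
open import Data.List.Membership.Propositional using (_∈_)
open import Data.List.Membership.Propositional.Properties
  using (∈-map⁺; ∈-tabulate⁺; ∈-concat⁺′; ∈-deduplicate⁺)
open import Data.List.Properties using (length-++; length-map; length-filter)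
open import Data.List.Relation.Unary.Any using (here; index)
open import Data.List.Relation.Unary.Any.Properties using (lookup-index)
import Data.List.Relation.Unary.Unique.DecPropositional.Properties as Unique
open import Data.Nat.Base using (zero; _+_; _*_; z≤n; z<s; s≤s; s<s; s<s⁻¹)
open import Data.Nat.ListAction using (sum)
open import Data.Nat.Properties hiding (_≟_)
open import Data.Nat.Tactic.RingSolver using (solve-∀)
open import Data.Product.Base using (_,_; proj₁; proj₂)
open import Data.Sum.Base as Sum using (_⊎_; inj₁; inj₂)
open import Data.Vec.Base as Vec using (Vec; []; _∷_; lookup; replicate)
open import Data.Vec.Functional using (updateAt)
open import Data.Vec.Functional.Properties
  using (updateAt-updates; updateAt-minimal)
open import Data.Vec.Properties
  using (≡-dec; lookup-replicate; lookup∘tabulate)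
open import Function.Base using (_∘_; const)
open import Function.Definitions using (Injective)
open import Relation.Binary.Definitions using (DecidableEquality)
open import Relation.Binary.PropositionalEquality
  using (_≢_; _≗_; refl; sym; trans; cong; cong₂; subst; subst₂; ≢-sym; module ≡-Reasoning)
open import Relation.Nullary using (yes; no; contradiction)

private
  variable
    A B : Set
    k m n t : ℕ

-- The ceiling of a fraction, pinned down by two inequalities.

ceiling-unique : ∀ N n γ → N ≤ suc n * γ → suc n * γ ≤ N + n →
                 + γ ≡ ceiling ((+ N) / suc n)
ceiling-unique N n γ N≤dγ dγ≤N+n = begin
  + γ            ≡⟨ ℤ.neg-involutive (+ γ) ⟨
  -- `ceiling` unfolds to `- q`, minus a floor. Both `- γ` and `q` satisfy
  -- `x * d ≤ - N < (1 + x) * d`, which has only one integer solution.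
  ℤ.- (ℤ.- + γ)  ≡⟨ cong ℤ.-_ (ℤ.≤-antisym (below lower upper′) (below lower′ upper)) ⟩
  ℤ.- q          ∎
  where
  open ≡-Reasoning
  d = + suc n
  q = (ℤ.- + N) ℤ./ d

  γd≡ : + (suc n * γ) ≡ + γ ℤ.* d
  γd≡ = trans (cong +_ (*-comm (suc n) γ)) (ℤ.pos-* γ (suc n))

  lower : (ℤ.- + γ) ℤ.* d ℤ.≤ ℤ.- + N
  lower = subst (ℤ._≤ ℤ.- + N) (trans (cong ℤ.-_ γd≡) (ℤ.neg-distribˡ-* (+ γ) d))
    (ℤ.neg-mono-≤ (ℤ.+≤+ N≤dγ))

  upper : ℤ.- + N ℤ.< ℤ.suc (ℤ.- + γ) ℤ.* d
  upper = subst₂ ℤ._<_ (cancel (+ N) (+ γ) d) (expand (+ N) (+ γ) d)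
    -- Adds `- N - γ * d` to both sides of `γ * d < N + d`.
    (ℤ.+-monoʳ-< (ℤ.- + N ℤ.- + γ ℤ.* d)
      (subst (ℤ._< + N ℤ.+ d) γd≡
        (ℤ.+<+ (≤-<-trans dγ≤N+n (+-monoʳ-< N (n<1+n n))))))
    where
    cancel : ∀ x y z → (ℤ.- x ℤ.- y ℤ.* z) ℤ.+ y ℤ.* z ≡ ℤ.- x
    cancel = ℤ.solve-∀
    expand : ∀ x y z → (ℤ.- x ℤ.- y ℤ.* z) ℤ.+ (x ℤ.+ z) ≡ (ℤ.1ℤ ℤ.+ ℤ.- y) ℤ.* z
    expand = ℤ.solve-∀

  lower′ : q ℤ.* d ℤ.≤ ℤ.- + N
  lower′ = ℤ.[n/d]*d≤n (ℤ.- + N) d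

  upper′ : ℤ.- + N ℤ.< ℤ.suc q ℤ.* d
  upper′ = subst (λ x → ℤ.- + N ℤ.< ℤ.suc x ℤ.* d)
    (sym (ℤ.div-pos-is-/ℕ (ℤ.- + N) (suc n))) (ℤ.n<s[n/ℕd]*d (ℤ.- + N) (suc n))

  below : ∀ {x y} → x ℤ.* d ℤ.≤ ℤ.- + N → ℤ.- + N ℤ.< ℤ.suc y ℤ.* d → x ℤ.≤ y
  below {x} {y} xd≤ <yd = subst₂ ℤ._≤_ (ℤ.pred-suc x) (ℤ.pred-suc y)
    (ℤ.pred-mono (ℤ.i<j⇒suc[i]≤j x<1+y))
    where
    x<1+y : x ℤ.< ℤ.suc y
    x<1+y = ℤ.*-cancelʳ-<-nonNeg d (ℤ.≤-<-trans xd≤ <yd)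

-- Sums whose terms are known up to an offset.

sum-shifted : ∀ {a b} (s : Fin n → ℕ) → (∀ j → s j + a ≡ b) →
              sum (tabulate s) + n * a ≡ n * b
sum-shifted {zero}          s eq = refl
sum-shifted {suc n} {a} {b} s eq = begin
  s zero + T + (a + n * a)    ≡⟨ +-interchange (s zero) T a (n * a) ⟩
  (s zero + a) + (T + n * a)  ≡⟨ cong₂ _+_ (eq zero) (sum-shifted (s ∘ suc) (eq ∘ suc)) ⟩
  b + n * b                   ∎
  where
  open ≡-Reasoning
  T = sum (tabulate (s ∘ suc))
  +-interchange : ∀ w x y z → w + x + (y + z) ≡ (w + y) + (x + z)
  +-interchange = solve-∀

-- A term meant as `b - a` enters as `s j + a ≡ b`, which avoids truncated subtraction. The
-- recursion walks to `i`; all terms after it are regular, so `sum-shifted` finishes.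
sum-shifted-except : ∀ {a b a′ b′} (s : Fin (suc n) → ℕ) i →
                     s i + a′ ≡ b′ → (∀ j → j ≢ i → s j + a ≡ b) →
                     sum (tabulate s) + (n * a + a′) ≡ n * b + b′
sum-shifted-except {n} {a} {b} {a′} {b′} s zero eq′ eq = begin
  s zero + T + (n * a + a′)    ≡⟨ swap (s zero) T (n * a) a′ ⟩
  (T + n * a) + (s zero + a′)  ≡⟨ cong₂ _+_ (sum-shifted (s ∘ suc) (λ j → eq (suc j) λ ())) eq′ ⟩
  n * b + b′                   ∎
  where
  open ≡-Reasoning
  T = sum (tabulate (s ∘ suc))
  swap : ∀ w x y z → w + x + (y + z) ≡ (x + y) + (w + z)
  swap = solve-∀
sum-shifted-except {suc n} {a} {b} {a′} {b′} s (suc i) eq′ eq = begin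
  s zero + T + (a + n * a + a′)      ≡⟨ rearrange (s zero) T a (n * a) a′ ⟩
  (s zero + a) + (T + (n * a + a′))  ≡⟨ cong₂ _+_ (eq zero λ ())
                                          (sum-shifted-except (s ∘ suc) i eq′
                                            λ j j≢i → eq (suc j) λ { refl → j≢i refl }) ⟩
  b + (n * b + b′)                   ≡⟨ +-assoc b (n * b) b′ ⟨
  b + n * b + b′                     ∎
  where
  open ≡-Reasoning
  T = sum (tabulate (s ∘ suc))
  rearrange : ∀ v w x y z → v + w + (x + y + z) ≡ (v + x) + (w + (y + z))
  rearrange = solve-∀

-- Auxiliary facts on lists and words.

length-deduplicate : (_≟_ : DecidableEquality A) (xs : List A) →
                     length (deduplicate _≟_ xs) ≤ length xs
length-deduplicate _≟_ []       = z≤n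
length-deduplicate _≟_ (x ∷ xs) =
  s≤s (≤-trans (length-filter _ (deduplicate _≟_ xs)) (length-deduplicate _≟_ xs))

lookup⇒replicate : (u : Vec A n) (x : A) → (∀ j → lookup u j ≡ x) → u ≡ replicate n x
lookup⇒replicate []      x eq = refl
lookup⇒replicate (y ∷ u) x eq = cong₂ _∷_ (eq zero) (lookup⇒replicate u x (eq ∘ suc))

-- Edges, classified by the first letter.

data SierpińskiAdjView {n t} : (u v : Vec (Fin n) (suc t)) → Set where
  cross  : ∀ {i j} → i ≢ j → SierpińskiAdjView (i ∷ replicate t j) (j ∷ replicate t i)
  within : ∀ {i u v} → SierpińskiAdj u v → SierpińskiAdjView (i ∷ u) (i ∷ v)

-- If the first letters differ, the condition on later positions forces both tails to be constant;
-- otherwise the edge lies inside one copy.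
view : (u v : Vec (Fin n) (suc t)) → SierpińskiAdj u v → SierpińskiAdjView u v
view (i ∷ u) (j ∷ v) (zero , _ , i≢j , after)
  with refl ← lookup⇒replicate u j (λ k → proj₁ (after (suc k) z<s))
     | refl ← lookup⇒replicate v i (λ k → proj₂ (after (suc k) z<s)) = cross i≢j
view (i ∷ u) (j ∷ v) (suc s , before , differ , after)
  with refl ← before zero z<s =
  within (s , (λ k k<s → before (suc k) (s<s k<s)) , differ
            , (λ k s<k → after (suc k) (s<s s<k)))

adj-cross : {i j : Fin n} → i ≢ j → SierpińskiAdj (i ∷ replicate t j) (j ∷ replicate t i)
adj-cross {i = i} {j} i≢j =
  zero , (λ _ ()) , i≢j ,
  λ { (suc k) _ → lookup-replicate k j , lookup-replicate k i }

adj-∷ : ∀ (i : Fin n) (u v : Vec (Fin n) t) →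
        SierpińskiAdj u v → SierpińskiAdj (i ∷ u) (i ∷ v)
adj-∷ i u v (s , before , differ , after) =
  suc s
  , (λ { zero _ → refl ; (suc k) sk<ss → before k (s<s⁻¹ sk<ss) })
  , differ
  , (λ { (suc k) ss<sk → after k (s<s⁻¹ ss<sk) })

-- Closed neighbourhoods.

replaceLast : Fin n → Vec (Fin n) (suc t) → Vec (Fin n) (suc t)
replaceLast a (i ∷ [])        = a ∷ []
replaceLast a (i ∷ u@(_ ∷ _)) = i ∷ replaceLast a u

_≟ᵥ_ : DecidableEquality (Vec (Fin n) t)
_≟ᵥ_ = ≡-dec _≟_

-- For u = w i j^r with i ≢ j and r ≥ 1, this is w j i^r.
flipTail : Vec (Fin n) (suc t) → Vec (Fin n) (suc t)
flipTail (i ∷ [])        = i ∷ []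
flipTail (i ∷ u@(j ∷ _)) with u ≟ᵥ replicate _ j
... | yes _ = j ∷ replicate _ i
... | no  _ = i ∷ flipTail u

replaceLast-self : (u : Vec (Fin n) (suc t)) → ∃[ a ] u ≡ replaceLast a u
replaceLast-self (i ∷ [])        = i , refl
replaceLast-self (i ∷ u@(_ ∷ _)) with a , eq ← replaceLast-self u = a , cong (i ∷_) eq

-- A crossing edge needs two distinct letters, so an edge at an extreme vertex stays within the copy
-- at every level, until only the last letter is left.
adj-constant : ∀ t i (v : Vec (Fin n) (suc t)) → SierpińskiAdj (replicate (suc t) i) v →
               ∃[ a ] v ≡ replaceLast a (replicate (suc t) i)
adj-constant zero    i (j ∷ []) _   = j , refl
adj-constant (suc t) i v        adj = go refl (view (replicate (suc (suc t)) i) v adj)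
  where
  go : ∀ {u v} → u ≡ replicate (suc (suc t)) i → SierpińskiAdjView u v →
       ∃[ a ] v ≡ replaceLast a u
  go refl (cross i≢i)        = contradiction refl i≢i
  go refl (within {v = v} adj) with a , eq ← adj-constant t i v adj = a , cong (i ∷_) eq

adj⇒replaceLast⊎flipTail : (u v : Vec (Fin n) (suc t)) → SierpińskiAdj u v →
                           (∃[ a ] v ≡ replaceLast a u) ⊎ v ≡ flipTail u
adj⇒replaceLast⊎flipTail {t = zero}  (i ∷ []) (j ∷ []) _ = inj₁ (j , refl)
adj⇒replaceLast⊎flipTail {t = suc t} u v adj with view u v adj
... | cross {i} {j} i≢j with replicate (suc t) j ≟ᵥ replicate (suc t) j
...   | yes _ = inj₂ refl
...   | no ≢  = contradiction refl ≢
adj⇒replaceLast⊎flipTail {t = suc t} _ _ _ | within {i} {u@(j ∷ _)} {v} adj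
  with u ≟ᵥ replicate _ j
-- Here `flipTail` acts at the first letter and not inside `u`. Since `u` is extreme in its copy,
-- its neighbours there differ from it only in the last letter.
... | yes refl with a , eq ← adj-constant t j v adj = inj₁ (a , cong (i ∷_) eq)
... | no  _    = Sum.map (λ (a , eq) → a , cong (i ∷_) eq) (cong (i ∷_))
                   (adj⇒replaceLast⊎flipTail u v adj)

-- A word is `replaceLast` of itself at its own last letter, so these `suc n` values cover its
-- closed neighbourhood.
closedNeighbour : Fin (suc n) → Vec (Fin n) (suc t) → Vec (Fin n) (suc t)
closedNeighbour zero    = flipTail
closedNeighbour (suc a) = replaceLast a

-- Stated for a single vertex because the induction uses sets that may leave prescribed vertices
-- undominated.
Dominates : List (Vec (Fin n) t) → Vec (Fin n) t → Set
Dominates D v = v ∈ D ⊎ (∃[ u ] u ∈ D × SierpińskiAdj v u)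

-- The dominator is given by its position `k` in `D`, so that the pairs of `c` and `k` number
-- `suc n * length D`.
dominates⇒closedNeighbour : ∀ {D} {v : Vec (Fin n) (suc t)} → Dominates D v →
  ∃[ c ] ∃[ k ] v ≡ closedNeighbour c (List.lookup D k)
dominates⇒closedNeighbour {v = v} (inj₁ v∈D)
  with a , eq ← replaceLast-self v =
  suc a , index v∈D , trans eq (cong (replaceLast a) (lookup-index v∈D))
dominates⇒closedNeighbour {n} {t} {v = v} (inj₂ (u , u∈D , v~u))
  with adj⇒replaceLast⊎flipTail u v (SierpińskiAdj-sym {n} {suc t} {v} {u} v~u)
... | inj₁ (a , eq) = suc a , index u∈D , trans eq (cong (replaceLast a) (lookup-index u∈D))
... | inj₂ eq       = zero  , index u∈D , trans eq (cong flipTail (lookup-index u∈D))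

-- The lower bound, by counting words.

funToFin-cong : {f g : Fin m → Fin n} → f ≗ g → funToFin f ≡ funToFin g
funToFin-cong {zero}  f≗g = refl
funToFin-cong {suc m} f≗g = cong₂ combine (f≗g zero) (funToFin-cong (f≗g ∘ suc))

word : Fin (n ^ t) → Vec (Fin n) t
word = Vec.tabulate ∘ finToFun

word-injective : Injective _≡_ _≡_ (word {n} {t})
word-injective {n} {t} {x} {y} eq = begin
  x                              ≡⟨ funToFin-finToFin {t} x ⟨
  funToFin (finToFun {n} {t} x)  ≡⟨ funToFin-cong finToFun-eq ⟩
  funToFin (finToFun {n} {t} y)  ≡⟨ funToFin-finToFin {t} y ⟩
  y                              ∎
  where
  open ≡-Reasoning
  finToFun-eq : finToFun {n} {t} x ≗ finToFun y
  finToFun-eq j = begin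
    finToFun x j       ≡⟨ lookup∘tabulate (finToFun x) j ⟨
    lookup (word x) j  ≡⟨ cong (λ v → lookup v j) eq ⟩
    lookup (word y) j  ≡⟨ lookup∘tabulate (finToFun y) j ⟩
    finToFun y j       ∎

-- The pair `c`, `k` determines the word it dominates, so coding words by such pairs is injective.
dominating⇒n^t≤[1+n]*length : (D : List (Vec (Fin n) (suc t))) → (∀ v → Dominates D v) →
                              n ^ suc t ≤ suc n * length D
dominating⇒n^t≤[1+n]*length {n} {t} D dom = injective⇒≤ {f = code} code-injective
  where
  dominator = λ (x : Fin (n ^ suc t)) → dominates⇒closedNeighbour (dom (word x))
  code : Fin (n ^ suc t) → Fin (suc n * length D)
  code x with c , k , _ ← dominator x = combine c k
  code-injective : Injective _≡_ _≡_ code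
  code-injective {x} {y} eq
    with c , k , eq₁ ← dominator x | c′ , k′ , eq₂ ← dominator y
    with refl , refl ← combine-injective c k c′ k′ eq = word-injective (trans eq₁ (sym eq₂))

-- Gluing sets from the copies.

glue : (Fin n → List (Vec (Fin n) t)) → List (Vec (Fin n) (suc t))
glue f = concat (tabulate (λ j → map (j ∷_) (f j)))

∈-glue⁺ : ∀ (f : Fin n → List (Vec (Fin n) t)) {j v} → v ∈ f j → j ∷ v ∈ glue f
∈-glue⁺ f {j} v∈fj = ∈-concat⁺′ (∈-map⁺ (j ∷_) v∈fj) (∈-tabulate⁺ j)

dominates-glue⁺ : ∀ (f : Fin n → List (Vec (Fin n) t)) {j v} →
                  Dominates (f j) v → Dominates (glue f) (j ∷ v)
dominates-glue⁺ f {j} {v} = Sum.map (∈-glue⁺ f)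
  (λ (u , u∈fj , v~u) → j ∷ u , ∈-glue⁺ f u∈fj , adj-∷ j v u v~u)

-- A general `g` in place of `_∷_` lets the recursion pass to `g ∘ suc`. The factor `c` goes inside
-- the sum so that its terms become weights.
*-length-concat-tabulate : ∀ c (g : Fin k → A → B) (f : Fin k → List A) →
  c * length (concat (tabulate (λ j → map (g j) (f j)))) ≡
  sum (tabulate (λ j → c * length (f j)))
*-length-concat-tabulate {zero}  c g f = *-zeroʳ c
*-length-concat-tabulate {suc k} c g f = begin
  c * length (map (g zero) (f zero) List.++ rest)
    ≡⟨ cong (c *_) (length-++ (map (g zero) (f zero))) ⟩
  c * (length (map (g zero) (f zero)) + length rest)
    ≡⟨ cong (λ l → c * (l + length rest)) (length-map (g zero) (f zero)) ⟩
  c * (length (f zero) + length rest)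
    ≡⟨ *-distribˡ-+ c (length (f zero)) (length rest) ⟩
  c * length (f zero) + c * length rest
    ≡⟨ cong (λ l → c * length (f zero) + l) (*-length-concat-tabulate c (g ∘ suc) (f ∘ suc)) ⟩
  c * length (f zero) + sum (tabulate (λ j → c * length (f (suc j)))) ∎
  where
  open ≡-Reasoning
  rest = concat (tabulate (λ j → map (g (suc j)) (f (suc j))))

-- Clearing the denominator `n + 1` turns the sizes of the codes into exact equations between
-- natural numbers.
weight : List (Vec (Fin n) t) → ℕ
weight {n} D = suc n * length D

weight-glue : ∀ {a b} (f : Fin n → List (Vec (Fin n) t)) →
              (∀ j → weight (f j) + a ≡ b) → weight (glue f) + n * a ≡ n * b
weight-glue {n} {a = a} f eq =
  trans (cong (_+ n * a) (*-length-concat-tabulate (suc n) _∷_ f)) (sum-shifted (weight ∘ f) eq)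

module _ {X Y : List (Vec (Fin (suc m)) t)} (i : Fin (suc m)) where

  oneDifferent : Fin (suc m) → List (Vec (Fin (suc m)) t)
  oneDifferent = updateAt (const Y) i (const X)

  oneDifferent-at : oneDifferent i ≡ X
  oneDifferent-at = updateAt-updates i (const Y)

  oneDifferent-off : ∀ {j} → j ≢ i → oneDifferent j ≡ Y
  oneDifferent-off {j} = updateAt-minimal j i (const Y)

  weight-glue-oneDifferent : ∀ {a b a′ b′} → weight X + a′ ≡ b′ → weight Y + a ≡ b →
    weight (glue oneDifferent) + (m * a + a′) ≡ m * b + b′
  weight-glue-oneDifferent {a} {b} {a′} {b′} eqX eqY =
    trans (cong (_+ (m * a + a′)) (*-length-concat-tabulate (suc (suc m)) _∷_ oneDifferent))
      (sum-shifted-except (weight ∘ oneDifferent) i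
        (subst (λ Z → weight Z + a′ ≡ b′) (sym oneDifferent-at) eqX)
        (λ j j≢i → subst (λ Z → weight Z + a ≡ b) (sym (oneDifferent-off j≢i)) eqY))

-- The codes and the induction on word length.

record EvenCodes (n t : ℕ) : Set where
  field
    all           : List (Vec (Fin n) t)
    all-dominates : ∀ v → Dominates all v
    all-extreme   : ∀ i → replicate t i ∈ all
    all-weight    : weight all ≡ n ^ t + n
    but           : Fin n → List (Vec (Fin n) t)
    but-dominates : ∀ i v → v ≢ replicate t i → Dominates (but i) v
    but-weight    : ∀ i → weight (but i) + 1 ≡ n ^ t

record OddCodes (n t : ℕ) : Set where
  field
    one             : Fin n → List (Vec (Fin n) t)
    one-dominates   : ∀ i v → Dominates (one i) v
    one-extreme     : ∀ i → replicate t i ∈ one i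
    one-weight      : ∀ i → weight (one i) ≡ n ^ t + 1
    inner           : List (Vec (Fin n) t)
    inner-dominates : ∀ v → (∀ i → v ≢ replicate t i) → Dominates inner v
    inner-weight    : weight inner + n ≡ n ^ t

-- The empty word is the extreme vertex of every letter: `all` must contain it, and `but i` has
-- nothing to dominate.
evenCodes-zero : ∀ n → EvenCodes n 0
evenCodes-zero n = record
  { all           = [] ∷ []
  ; all-dominates = λ { [] → inj₁ (here refl) }
  ; all-extreme   = λ _ → here refl
  ; all-weight    = cong suc (*-identityʳ n)
  ; but           = λ _ → []
  ; but-dominates = λ { i [] []≢[] → contradiction refl []≢[] }
  ; but-weight    = λ _ → cong (_+ 1) (*-zeroʳ n)
  }

-- For `one i`, copy `i` takes `all` and the others take `but i`. In copy `j` only `j i^t` may be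
-- missed; its neighbour `i j^t` is chosen, as `all` contains every extreme vertex. For `inner`,
-- copy `j` takes `but j`, which may miss only the extreme vertex `j j^t`.
oddCodes-suc : EvenCodes (suc m) t → OddCodes (suc m) (suc t)
oddCodes-suc {m} {t} C = record
  { one             = glue ∘ f
  ; one-dominates   = one-dominates
  ; one-extreme     = λ i → ∈-glue⁺ (f i) (extreme∈f i i)
  -- The offset from gluing is `m * 1 + 0`: one for each `but i`, none for `all`.
  ; one-weight      = λ i → +-cancelʳ-≡ m _ _ (trans
      (cong (λ a → weight (glue (f i)) + a) (sym (trans (+-identityʳ _) (*-identityʳ m))))
      (trans (weight-glue-oneDifferent i (trans (+-identityʳ _) all-weight) (but-weight i))
             (arith m (suc m ^ t))))
  ; inner           = glue but
  ; inner-dominates = inner-dominates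
  ; inner-weight    = trans (cong (λ a → weight (glue but) + a) (sym (*-identityʳ (suc m))))
                            (weight-glue but but-weight)
  }
  where
  open EvenCodes C
  f : Fin (suc m) → Fin (suc m) → List (Vec (Fin (suc m)) t)
  f i = oneDifferent {X = all} {Y = but i} i

  extreme∈f : ∀ i j → replicate t j ∈ f i i
  extreme∈f i j = subst (replicate t j ∈_) (sym (oneDifferent-at i)) (all-extreme j)

  one-dominates : ∀ i v → Dominates (glue (f i)) v
  one-dominates i (j ∷ v) with j ≟ i | v ≟ᵥ replicate t i
  ... | yes refl | _        = dominates-glue⁺ (f i)
    (subst (λ Z → Dominates Z v) (sym (oneDifferent-at i)) (all-dominates v))
  ... | no j≢i   | yes refl =
    inj₂ (i ∷ replicate t j , ∈-glue⁺ (f i) (extreme∈f i j) , adj-cross j≢i)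
  ... | no j≢i   | no v≢iᵗ  = dominates-glue⁺ (f i)
    (subst (λ Z → Dominates Z v) (sym (oneDifferent-off i j≢i)) (but-dominates i v v≢iᵗ))

  inner-dominates : ∀ v → (∀ i → v ≢ replicate (suc t) i) → Dominates (glue but) v
  inner-dominates (j ∷ v) v≢ =
    dominates-glue⁺ but (but-dominates j v (v≢ j ∘ cong (j ∷_)))

  arith : ∀ m N → m * N + (N + suc m) ≡ (N + m * N) + 1 + m
  arith = solve-∀

-- For `all`, copy `j` takes `one j`, hence contains `j j^t`. For `but i`, copy `i` takes `inner`
-- and the others take `one i`. Only words `i k^t` may be missed in copy `i`; if `k` differs from
-- `i`, the neighbour `k i^t` is chosen, as `one i` contains `i^t`.
evenCodes-suc : OddCodes (suc m) t → EvenCodes (suc m) (suc t)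
evenCodes-suc {m} {t} C = record
  { all           = glue one
  ; all-dominates = λ { (j ∷ v) → dominates-glue⁺ one (one-dominates j v) }
  ; all-extreme   = λ i → ∈-glue⁺ one (one-extreme i)
  ; all-weight    = +-cancelʳ-≡ (suc m * 0) _ _
      (trans (weight-glue one (λ j → trans (+-identityʳ _) (one-weight j)))
             (arith₁ m (suc m ^ t)))
  ; but           = glue ∘ f
  ; but-dominates = but-dominates
  -- Gluing gives the offset `suc m` of `inner`, so `m` is added to the required 1 and cancelled
  -- afterwards.
  ; but-weight    = λ i → +-cancelʳ-≡ m _ _ (trans (arith₂ m (weight (glue (f i))))
      (trans (weight-glue-oneDifferent i inner-weight (trans (+-identityʳ _) (one-weight i)))
             (arith₃ m (suc m ^ t))))
  }
  where
  open OddCodes C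
  f : Fin (suc m) → Fin (suc m) → List (Vec (Fin (suc m)) t)
  f i = oneDifferent {X = inner} {Y = one i} i

  but-dominates : ∀ i v → v ≢ replicate (suc t) i → Dominates (glue (f i)) v
  but-dominates i (j ∷ v) jv≢ with j ≟ i | any? (λ k → v ≟ᵥ replicate t k)
  ... | no j≢i   | _              = dominates-glue⁺ (f i)
    (subst (λ Z → Dominates Z v) (sym (oneDifferent-off i j≢i)) (one-dominates i v))
  ... | yes refl | yes (k , refl) =
    inj₂ (k ∷ replicate t i , ∈-glue⁺ (f i) iᵗ∈fk , adj-cross (≢-sym k≢i))
    where
    k≢i : k ≢ i
    k≢i refl = jv≢ refl
    iᵗ∈fk : replicate t i ∈ f i k
    iᵗ∈fk = subst (replicate t i ∈_) (sym (oneDifferent-off i k≢i)) (one-extreme i)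
  ... | yes refl | no ∄k          = dominates-glue⁺ (f i)
    (subst (λ Z → Dominates Z v) (sym (oneDifferent-at i))
      (inner-dominates v (λ k v≡kᵗ → ∄k (k , v≡kᵗ))))

  arith₁ : ∀ m N → suc m * (N + 1) ≡ (N + m * N) + suc m + suc m * 0
  arith₁ = solve-∀
  arith₂ : ∀ m w → w + 1 + m ≡ w + (m * 0 + suc m)
  arith₂ = solve-∀
  arith₃ : ∀ m N → m * (N + 1) + N ≡ (N + m * N) + m
  arith₃ = solve-∀

-- Assembling the domination number.

codes : ∀ m t → EvenCodes (suc m) t ⊎ OddCodes (suc m) t
codes m zero    = inj₁ (evenCodes-zero (suc m))
-- Each new letter exchanges the two kinds of codes, hence the swap.
codes m (suc t) = Sum.swap (Sum.map oddCodes-suc evenCodes-suc (codes m t))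

-- In both parities the excess over `n ^ t` is at most `n`, less than the weight `n + 1` of a single
-- vertex; this makes the set optimal.
∃-dominating : ∀ m t → ∃[ D ] (∀ v → Dominates D v) × weight D ≤ suc m ^ t + suc m
∃-dominating m t with codes m t
... | inj₁ C = all , all-dominates , ≤-reflexive all-weight
  where open EvenCodes C
... | inj₂ C = one zero , one-dominates zero ,
               ≤-trans (≤-reflexive (one-weight zero)) (+-monoʳ-≤ (suc m ^ t) (s≤s z≤n))
  where open OddCodes C

theorem3p1 : (n t : ℕ) → 2 ≤ n → 1 ≤ t →
    ∃[ γ ] IsDominationNumber (Sierpiński n t) γ × + γ ≡ ceiling ((+ (n ^ t)) / suc n)
theorem3p1 n@(suc m) t@(suc _) _ _ with D , dom , weight≤ ← ∃-dominating m t =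
  length D! ,
  ((D! , (Unique.deduplicate-! _≟ᵥ_ D , dom!) , refl) , minimal) ,
  ceiling-unique (n ^ t) n (length D!) (dominating⇒n^t≤[1+n]*length D! dom!) weight!≤
  where
  -- Deduplication supplies `Unique` and cannot lengthen the list, so the weight bound survives.
  D! = deduplicate _≟ᵥ_ D

  dom! : ∀ v → Dominates D! v
  dom! v = Sum.map (∈-deduplicate⁺ _≟ᵥ_)
    (λ (u , u∈D , v~u) → u , ∈-deduplicate⁺ _≟ᵥ_ u∈D , v~u) (dom v)

  weight!≤ : suc n * length D! ≤ n ^ t + n
  weight!≤ = ≤-trans (*-monoʳ-≤ (suc n) (length-deduplicate _≟ᵥ_ D)) weight≤

  minimal : ∀ E → IsDominatingSet (Sierpiński n t) E → length D! ≤ length E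
  -- The slack `n` is below one multiple of `suc n`, so dividing gives `length D! < suc (length E)`.
  minimal E (_ , domE) = m<1+n⇒m≤n (*-cancelˡ-< (suc n) _ _ (begin-strict
    suc n * length D!          ≤⟨ weight!≤ ⟩
    n ^ t + n                  ≤⟨ +-monoˡ-≤ n (dominating⇒n^t≤[1+n]*length E domE) ⟩
    suc n * length E + n       <⟨ n<1+n _ ⟩
    suc (suc n * length E + n) ≡⟨ arith n (length E) ⟩
    suc n * suc (length E)     ∎))
    where
    open ≤-Reasoning
    arith : ∀ n e → suc (suc n * e + n) ≡ suc n * suc e
    arith = solve-∀
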